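{- For all integers $r \ge 1$ and $s \ge t \ge 2$, we have $R_r^{KG}(s,t) \ge sr + (t-2)(s-1)$.
   Context: For positive integers $n$ and $r$, the Kneser graph $KG(n,r)$ is the graph whose vertices are the $r$-element subsets of $[n]=\{1,\dots,n\}$, two vertices being adjacent precisely when the corresponding sets are disjoint. The $r$-Kneser Ramsey number $R_r^{KG}(s,t)$ is the minimum integer $n$ such that every red/blue coloring of the edges of $KG(n,r)$ contains a red copy of the complete graph $K_s$ (all of whose edges are red) or a blue copy of the complete graph $K_t$ (all of whose edges are blue). -}

module Defs where

open import Data.Fin.Base using (Fin)
open import Data.Fin.Subset using (Subset; _∩_; Empty; ∣_∣)
open import Data.Fin.Subset.Properties using (∩-comm; ∩-idem; ∣⊥∣≡0; Empty-unique)
open import Data.Nat.Base using (ℕ; NonZero; _≤_; ≢-nonZero⁻¹)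
open import Data.Product.Base using (Σ-syntax; _×_; _,_; proj₁)
open import Data.Sum.Base using (_⊎_)
open import Function.Definitions using (Injective)
open import Relation.Binary.Definitions using (Symmetric; Irreflexive)
open import Relation.Binary.PropositionalEquality
  using (_≡_; _≢_; refl; sym; trans; cong; subst)

record SimpleGraph : Set₁ where
  field
    Vertex : Set
    Adj    : Vertex → Vertex → Set
    symm   : Symmetric Adj
    irrefl : Irreflexive _≡_ Adj

-- The r-element subsets of Fin n, which plays the role of [n].
KneserVertex : ℕ → ℕ → Set
KneserVertex n r = Σ[ p ∈ Subset n ] ∣ p ∣ ≡ r

Disjoint : ∀ {n r} → KneserVertex n r → KneserVertex n r → Set
Disjoint u v = Empty (proj₁ u ∩ proj₁ v)

-- r ≥ 1 is needed for looplessness: the empty set is disjoint from itself.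
-- n = 0 is allowed; KG 0 r then has no vertices.
KG : (n r : ℕ) → .{{NonZero r}} → SimpleGraph
KG n r = record
  { Vertex = KneserVertex n r
  ; Adj    = Disjoint
  ; symm   = λ { {p , _} {q , _} → subst Empty (∩-comm p q) }
  ; irrefl = λ { {p , ∣p∣≡r} refl disj → ≢-nonZero⁻¹ r
      (trans (sym ∣p∣≡r)
        (trans (cong ∣_∣ (Empty-unique (subst Empty (∩-idem p) disj))) (∣⊥∣≡0 n))) }
  }

data Colour : Set where
  red blue : Colour

-- The adjacency proof is irrelevant, so the colour depends only on the
-- endpoints, and symmetry makes it a function of the unordered edge.
record EdgeColouring (G : SimpleGraph) : Set where
  open SimpleGraph G
  field
    colour      : (u v : Vertex) → .(Adj u v) → Colour
    colour-symm : ∀ u v (e : Adj u v) → colour u v e ≡ colour v u (symm e)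

-- A copy of the complete graph K_k in G, all of whose edges have colour x.
record MonochromaticK {G : SimpleGraph} (c : EdgeColouring G)
                      (x : Colour) (k : ℕ) : Set where
  open SimpleGraph G
  open EdgeColouring c
  field
    vertex     : Fin k → Vertex
    injective  : Injective _≡_ _≡_ vertex
    adjacent   : ∀ {i j} → i ≢ j → Adj (vertex i) (vertex j)
    monochrome : ∀ {i j} (i≢j : i ≢ j) →
                 colour (vertex i) (vertex j) (adjacent i≢j) ≡ x

KneserRamsey : (r s t : ℕ) → .{{NonZero r}} → ℕ → Set
KneserRamsey r s t n =
  (c : EdgeColouring (KG n r)) → MonochromaticK c red s ⊎ MonochromaticK c blue t

IsMinimum : (ℕ → Set) → ℕ → Set
IsMinimum P n = P n × (∀ m → P m → n ≤ m)

-- "R is the r-Kneser Ramsey number R_r^{KG}(s,t)", as a relation.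
IsKneserRamseyNumber : (r s t : ℕ) → .{{NonZero r}} → ℕ → Set
IsKneserRamseyNumber r s t R = IsMinimum (KneserRamsey r s t) R

{-# OPTIONS --safe #-}
-- Put a = s r − 1 and split a ground set of at most a + (t − 2)(s − 1) points
-- into one part of size at most a and t − 2 blocks of size at most s − 1.
-- An r-set inside the first part gets class 0, any other one the class of some
-- block that it meets.  Edges within a class are red, the others blue.  All
-- vertices of a red clique lie in one class: s disjoint r-sets do
-- not fit into a points, nor can s disjoint sets all meet a block of s − 1
-- points.  A blue clique has at most one vertex in each of the t − 1 classes.
module Submission where

open import Defs
open import Data.Fin.Base
  using (Fin; zero; suc; toℕ; splitAt; combine; inject≤; quotient; remainder; _↑ˡ_; _↑ʳ_)
import Data.Fin.Properties as Fin
open import Data.Fin.Subset using (Subset; _∈_; _∩_; _∪_; ⊥; Empty; ∣_∣; inside; outside)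
open import Data.Fin.Subset.Properties
  using (_∈?_; x∈p∩q⁺; x∈p∩q⁻; x∈p∪q⁻; ∉⊥; drop-∷-Empty; Empty-unique; ∣⊥∣≡0)
open import Data.Nat.Base using (ℕ; zero; suc; NonZero; _+_; _*_; _∸_; _≥_; _≤_; _<_; z≤n; s≤s; s≤s⁻¹)
import Data.Nat.Properties as ℕ
open import Data.Product.Base using (∃; ∃₂; _×_; _,_; proj₁; proj₂)
open import Data.Sum.Base using (inj₁; inj₂; [_,_]′)
open import Data.Vec.Base using ([]; _∷_; here; there)
open import Function.Base using (_∘_)
open import Relation.Binary.PropositionalEquality
  using (_≡_; _≢_; refl; sym; trans; cong; cong₂; subst)
open import Relation.Nullary.Decidable using (Dec; yes; no; _×-dec_)
open import Relation.Nullary.Negation using (¬_; contradiction)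

∣p∪q∣≡∣p∣+∣q∣ : ∀ {n} (p q : Subset n) → Empty (p ∩ q) → ∣ p ∪ q ∣ ≡ ∣ p ∣ + ∣ q ∣
∣p∪q∣≡∣p∣+∣q∣ []            []            _ = refl
∣p∪q∣≡∣p∣+∣q∣ (outside ∷ p) (outside ∷ q) e = ∣p∪q∣≡∣p∣+∣q∣ p q (drop-∷-Empty e)
∣p∪q∣≡∣p∣+∣q∣ (inside  ∷ p) (outside ∷ q) e = cong suc (∣p∪q∣≡∣p∣+∣q∣ p q (drop-∷-Empty e))
∣p∪q∣≡∣p∣+∣q∣ (outside ∷ p) (inside  ∷ q) e =
  trans (cong suc (∣p∪q∣≡∣p∣+∣q∣ p q (drop-∷-Empty e))) (sym (ℕ.+-suc ∣ p ∣ ∣ q ∣))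
∣p∪q∣≡∣p∣+∣q∣ (inside  ∷ p) (inside  ∷ q) e = contradiction (zero , here) e

⋃ᶠ : ∀ {n k} → (Fin k → Subset n) → Subset n
⋃ᶠ {k = zero}  F = ⊥
⋃ᶠ {k = suc k} F = F zero ∪ ⋃ᶠ (F ∘ suc)

x∈⋃ᶠ⁻ : ∀ {n k} (F : Fin k → Subset n) {x} → x ∈ ⋃ᶠ F → ∃ λ i → x ∈ F i
x∈⋃ᶠ⁻ {k = zero}  F x∈ = contradiction x∈ ∉⊥
x∈⋃ᶠ⁻ {k = suc k} F x∈ with x∈p∪q⁻ (F zero) (⋃ᶠ (F ∘ suc)) x∈
... | inj₁ x∈F₀ = zero , x∈F₀
... | inj₂ x∈F₊ with i , x∈Fᵢ ← x∈⋃ᶠ⁻ (F ∘ suc) x∈F₊ = suc i , x∈Fᵢ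

∣⋃ᶠ∣ : ∀ {n k r} (F : Fin k → Subset n) → (∀ i → ∣ F i ∣ ≡ r) →
       (∀ {i j} → i ≢ j → Empty (F i ∩ F j)) → ∣ ⋃ᶠ F ∣ ≡ k * r
∣⋃ᶠ∣ {n} {zero}  F size disj = ∣⊥∣≡0 n
∣⋃ᶠ∣ {n} {suc k} F size disj = trans
  (∣p∪q∣≡∣p∣+∣q∣ (F zero) (⋃ᶠ (F ∘ suc)) λ (x , x∈) →
    let x∈F₀ , x∈F₊ = x∈p∩q⁻ _ _ x∈
        i , x∈Fᵢ    = x∈⋃ᶠ⁻ (F ∘ suc) x∈F₊
    in disj {zero} {suc i} (λ ()) (x , x∈p∩q⁺ (x∈F₀ , x∈Fᵢ)))
  (cong₂ _+_ (size zero)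
    (∣⋃ᶠ∣ (F ∘ suc) (size ∘ suc) (λ i≢j → disj (i≢j ∘ Fin.suc-injective))))

-- Dropping the first position shifts the other elements down by one, so the bound falls with it; at
-- bound 0 nothing is left.
∣p∣≤bound : ∀ {n} (p : Subset n) a → (∀ {x} → x ∈ p → toℕ x < a) → ∣ p ∣ ≤ a
∣p∣≤bound {n} p zero below = ℕ.≤-reflexive
  (trans (cong ∣_∣ (Empty-unique {p = p} λ (_ , x∈p) → ℕ.n≮0 (below x∈p))) (∣⊥∣≡0 n))
∣p∣≤bound []            (suc a) below = z≤n
∣p∣≤bound (inside  ∷ p) (suc a) below = s≤s (∣p∣≤bound p a (s≤s⁻¹ ∘ below ∘ there))
∣p∣≤bound (outside ∷ p) (suc a) below = ℕ.m≤n⇒m≤1+n (∣p∣≤bound p a (s≤s⁻¹ ∘ below ∘ there))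

dichromatic : ∀ {P : Set} → Dec P → Colour
dichromatic (yes _) = red
dichromatic (no  _) = blue

dichromatic-red : ∀ {P : Set} (P? : Dec P) → dichromatic P? ≡ red → P
dichromatic-red (yes p) _ = p

dichromatic-blue : ∀ {P : Set} (P? : Dec P) → dichromatic P? ≡ blue → ¬ P
dichromatic-blue (no ¬p) _ = ¬p

dichromatic-cong : ∀ {P Q : Set} (P? : Dec P) (Q? : Dec Q) → (P → Q) → (Q → P) →
                   dichromatic P? ≡ dichromatic Q?
dichromatic-cong (yes _) (yes _) _ _ = refl
dichromatic-cong (no  _) (no  _) _ _ = refl
dichromatic-cong (yes p) (no ¬q) f _ = contradiction (f p) ¬q
dichromatic-cong (no ¬p) (yes q) _ g = contradiction (g q) ¬p

module _ {G : SimpleGraph} {k} (class : SimpleGraph.Vertex G → Fin k) where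

  classColouring : EdgeColouring G
  classColouring = record
    { colour      = λ u v _ → dichromatic (class u Fin.≟ class v)
    ; colour-symm = λ u v _ → dichromatic-cong (class u Fin.≟ class v) (class v Fin.≟ class u) sym sym
    }

  -- All pairs in a clique are adjacent, so each vertex is compared with vertex zero directly; the
  -- size `suc s` ensures that it exists.
  red-class : ∀ {s} (K : MonochromaticK classColouring red (suc s)) →
              let open MonochromaticK K in ∀ i → class (vertex i) ≡ class (vertex zero)
  red-class K i with i Fin.≟ zero
  ... | yes refl = refl
  ... | no  i≢0  = dichromatic-red _ (MonochromaticK.monochrome K i≢0)

  no-blue : ¬ MonochromaticK classColouring blue (suc k)
  no-blue K =
    let open MonochromaticK K
        i , j , i<j , eq = Fin.pigeonhole (ℕ.n<1+n k) (class ∘ vertex)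
    in dichromatic-blue _ (monochrome (Fin.<⇒≢ i<j)) eq

module BlockColouring {n} a k q (n≤ : n ≤ a + k * q) where

  -- `inject≤` places the ground set in `Fin (a + k * q)`: the first `a` values form the low part,
  -- and `a ↑ʳ y` lies in block `quotient q y`. As a set may meet several blocks, `high` records one
  -- chosen point.
  data Position (p : Subset n) : Set where
    low  : (∀ {x} → x ∈ p → toℕ x < a) → Position p
    high : ∀ x (y : Fin (k * q)) → x ∈ p → inject≤ x n≤ ≡ a ↑ʳ y → Position p

  position : ∀ p → Position p
  position p with Fin.any? (λ x → Fin.any? (λ y → (x ∈? p) ×-dec (inject≤ x n≤ Fin.≟ a ↑ʳ y)))
  ... | yes (x , y , x∈p , eq) = high x y x∈p eq
  ... | no  none               = low below
    where
    below : ∀ {x} → x ∈ p → toℕ x < a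
    below {x} x∈p with splitAt a (inject≤ x n≤) in eq
    ... | inj₂ y = contradiction (x , y , x∈p , sym (Fin.splitAt⁻¹-↑ʳ eq)) none
    -- `inject≤` keeps values, so `toℕ x` equals `toℕ z` with `z : Fin a`.
    ... | inj₁ z = subst (_< a)
      (trans (sym (Fin.toℕ-↑ˡ z (k * q)))
        (trans (cong toℕ (Fin.splitAt⁻¹-↑ˡ eq)) (Fin.toℕ-inject≤ x n≤)))
      (Fin.toℕ<n z)

  index : ∀ {p} → Position p → Fin (suc k)
  index (low _)        = zero
  index (high _ y _ _) = suc (quotient q y)

  index≡0⇒below : ∀ {p} (P : Position p) → index P ≡ zero → ∀ {x} → x ∈ p → toℕ x < a
  index≡0⇒below (low below) _ = below

  index≡suc⇒representative : ∀ {p b} (P : Position p) → index P ≡ suc b →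
    ∃₂ λ x y → x ∈ p × inject≤ x n≤ ≡ a ↑ʳ y × quotient q y ≡ b
  index≡suc⇒representative (high x y x∈p eq) refl = x , y , x∈p , eq , refl

  -- By disjointness the union has `s * r` elements, yet all of them lie below `a`.
  no-low-family : ∀ {s r} → a < s * r → (F : Fin s → Subset n) → (∀ i → ∣ F i ∣ ≡ r) →
                  (∀ {i j} → i ≢ j → Empty (F i ∩ F j)) →
                  ¬ (∀ i → index (position (F i)) ≡ zero)
  no-low-family {s} {r} a<sr F size disj index≡0 = ℕ.<⇒≱ a<sr
    (subst (_≤ a) (∣⋃ᶠ∣ F size disj) (∣p∣≤bound (⋃ᶠ F) a λ x∈ →
      let i , x∈Fᵢ = x∈⋃ᶠ⁻ F x∈ in index≡0⇒below (position (F i)) (index≡0 i) x∈Fᵢ))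

  -- The chosen points all lie in block `b`, where only `q` remainders are available. Two of them
  -- therefore coincide, and the shared point contradicts disjointness.
  no-high-family : ∀ {s} b → q < s → (F : Fin s → Subset n) →
                   (∀ {i j} → i ≢ j → Empty (F i ∩ F j)) →
                   ¬ (∀ i → index (position (F i)) ≡ suc b)
  no-high-family b q<s F disj index≡b =
    let rep = λ i → index≡suc⇒representative (position (F i)) (index≡b i)
        y   = λ i → proj₁ (proj₂ (rep i))
        i , j , i<j , eq       = Fin.pigeonhole q<s (remainder {k} q ∘ y)
        xᵢ , yᵢ , xᵢ∈ , eᵢ , bᵢ = rep i
        xⱼ , yⱼ , xⱼ∈ , eⱼ , bⱼ = rep j
        -- Block number and remainder together determine `y`.
        yᵢ≡yⱼ = trans (sym (Fin.combine-remQuot {k} q yᵢ))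
                  (trans (cong₂ combine (trans bᵢ (sym bⱼ)) eq) (Fin.combine-remQuot {k} q yⱼ))
        xᵢ≡xⱼ = Fin.inject≤-injective n≤ n≤ xᵢ xⱼ
                  (trans eᵢ (trans (cong (a ↑ʳ_) yᵢ≡yⱼ) (sym eⱼ)))
    in disj (Fin.<⇒≢ i<j) (xᵢ , x∈p∩q⁺ (xᵢ∈ , subst (_∈ F j) (sym xᵢ≡xⱼ) xⱼ∈))

¬KneserRamsey : ∀ r s k .{{_ : NonZero r}} {a n} → a < suc s * r → n ≤ a + k * s →
                ¬ KneserRamsey r (suc s) (suc (suc k)) n
¬KneserRamsey r s k {a} {n} a<sr n≤ ramsey =
  [ no-red , no-blue class ]′ (ramsey (classColouring class))
  where
  open BlockColouring a k s n≤

  class : KneserVertex n r → Fin (suc k)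
  class (p , _) = index (position p)

  no-red : ¬ MonochromaticK (classColouring {KG n r} class) red (suc s)
  -- Abstracting the class of vertex zero also in the type of `same` lets one case split decide
  -- which family the whole clique forms.
  no-red K with class (MonochromaticK.vertex K zero) | red-class {KG n r} class K
  ... | zero  | same = no-low-family a<sr (proj₁ ∘ vertex) (proj₂ ∘ vertex) adjacent same
    where open MonochromaticK K
  ... | suc b | same = no-high-family b (ℕ.n<1+n s) (proj₁ ∘ vertex) adjacent same
    where open MonochromaticK K

theorem1p4 : (r s t : ℕ) → .{{_ : NonZero r}} → s ≥ t → t ≥ 2 →
    (R : ℕ) → IsKneserRamseyNumber r s t R →
    R ≥ s * r + (t ∸ 2) * (s ∸ 1)
theorem1p4 (suc r) (suc s) (suc (suc k)) (s≤s _) (s≤s (s≤s _)) R (ramsey , _) =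
  -- Here `a` is `r + s * suc r`, the predecessor of `suc s * suc r` by computation. The claimed
  -- bound thus reduces to `suc (a + k * s)`, and `s≤s⁻¹` turns `R<` into `R ≤ a + k * s`.
  ℕ.≮⇒≥ λ R< → ¬KneserRamsey (suc r) s k (ℕ.n<1+n (r + s * suc r)) (s≤s⁻¹ R<) ramsey
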